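{- Let $\Upsilon$, $\pi$ and $t$ be a fixed-point context, a permutation and a nominal term, respectively, and let $\overline c$ be a finite (possibly empty) list of newly quantified atoms. Then $\Upsilon\vdash\mathsf{N}\overline c.\,\pi\curlywedge t$ is derivable if and only if $\Upsilon\vdash\mathsf{N}\overline c.\,\pi\cdot t\stackrel{\curlywedge}{\approx}_\alpha t$ is derivable.
   Context: **Syntax.** Fix a countably infinite set $\mathbb{A}$ of atoms $a,b,c,\dots$ (distinct letters denote distinct atoms), a countably infinite set of variables $X,Y,\dots$, and a countable set of function symbols. A permutation is a bijection $\pi:\mathbb{A}\to\mathbb{A}$ with $\mathrm{supp}(\pi)=\{a\mid\pi(a)\neq a\}$ finite; $(a\ b)$ is a swapping. Nominal terms: $s,t::=a\mid[a]t\mid(t_1,\dots,t_n)\mid f\,t\mid\pi\cdot X$ (not quotiented by $\alpha$-renaming; $X$ abbreviates $Id\cdot X$). Permutation action: $\pi\cdot a=\pi(a)$, $\pi\cdot[a]t=[\pi(a)](\pi\cdot t)$, $\pi\cdot(\pi'\cdot X)=(\pi\circ\pi')\cdot X$, and componentwise on tuples and applications. Conjugate: $\pi^{\rho}=\rho\circ\pi\circ\rho^{ -1}$. **Judgements.** A fixed-point context $\Upsilon$ is a finite set of constraints $\pi\curlywedge X$. Put $\mathrm{supp}(\mathrm{perm}(\Upsilon|_X))=\bigcup\{\mathrm{supp}(\pi)\mid\pi\curlywedge X\in\Upsilon\}$. In judgements, $\overline c$ is a finite, possibly empty, list of newly quantified atoms ($\mathsf N$ is the nominal "new" quantifier, omitted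 when $\overline c$ is empty). Rules for $\Upsilon\vdash\mathsf{N}\overline c.\,\pi\curlywedge t$: - $\Upsilon\vdash\mathsf{N}\overline c.\,\pi\curlywedge a$ if $\pi(a)=a$; - $\Upsilon\vdash\mathsf{N}\overline c.\,\pi\curlywedge\pi'\cdot X$ if $\mathrm{supp}(\pi^{\pi'^{ -1}})\setminus\{\overline c\}\subseteq\mathrm{supp}(\mathrm{perm}(\Upsilon|_X))$; - from $\Upsilon\vdash\mathsf{N}\overline c.\,\pi\curlywedge t$ infer $\Upsilon\vdash\mathsf{N}\overline c.\,\pi\curlywedge f\,t$; - from $\Upsilon\vdash\mathsf{N}\overline c.\,\pi\curlywedge t_i$ for all $i$ infer $\Upsilon\vdash\mathsf{N}\overline c.\,\pi\curlywedge(t_1,\dots,t_n)$; - from $\Upsilon\vdash\mathsf{N}\overline c,c_1.\,\pi\curlywedge(a\ c_1)\cdot t$ infer $\Upsilon\vdash\mathsf{N}\overline c.\,\pi\curlywedge[a]t$, with $c_1$ a new atom not occurring in the conclusion. Rules for $\Upsilon\vdash\mathsf{N}\overline c.\,s\stackrel{\curlywedge}{\approx}_\alpha t$: - $\Upsilon\vdash\mathsf{N}\overline c.\,a\stackrel{\curlywedge}{\approx}_\alpha a$; - $\Upsilon\vdash\mathsf{N}\overline c.\,\pi\cdot X\stackrel{\curlywedge}{\approx}_\alpha\pi'\cdot X$ if $\mathrm{supp}((\pi')^{ -1}\circ\pi)\setminus\{\overline c\}\subseteq\mathrm{supp}(\mathrm{perm}(\Upsilon|_X))$; - congruence (same $\overline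 c$) for $f$, for tuples of the same length, and for abstractions $[a]t,[a]t'$ of the same atom; - from $\Upsilon\vdash\mathsf{N}\overline c.\,s\stackrel{\curlywedge}{\approx}_\alpha(a\ b)\cdot t$ and $\Upsilon\vdash\mathsf{N}\overline c,c_1.\,(a\ c_1)\curlywedge t$ infer $\Upsilon\vdash\mathsf{N}\overline c.\,[a]s\stackrel{\curlywedge}{\approx}_\alpha[b]t$ ($a\neq b$, $c_1$ a new atom not occurring in the conclusion). -}

module Defs where

open import Data.Empty using (⊥-elim)
open import Data.List.Base using (List; []; _∷_; _++_)
open import Data.List.Membership.Propositional using (_∈_; _∉_)
open import Data.List.Membership.Propositional.Properties using (∈-++⁺ˡ; ∈-++⁺ʳ)
open import Data.List.Relation.Binary.Pointwise.Base using (Pointwise)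
open import Data.List.Relation.Unary.All using (All)
open import Data.List.Relation.Unary.Any using (Any; here; there)
open import Data.Nat.Base using (ℕ)
open import Data.Nat.Properties using (_≟_)
open import Data.Product.Base using (∃-syntax; _×_; _,_)
open import Function.Bundles using (_↔_; mk↔ₛ′; Inverse)
open import Function.Construct.Composition using (_↔-∘_)
open import Function.Construct.Symmetry using (↔-sym)
open import Level using (0ℓ)
open import Relation.Binary.PropositionalEquality using (_≡_; _≢_; refl; sym; trans; cong)
open import Relation.Nullary using (¬_; yes; no)
open import Relation.Unary using (Pred; _⊆_; _∖_)

Atom : Set
Atom = ℕ

Var : Set
Var = ℕ

moved : Atom ↔ Atom → Pred Atom 0ℓ
moved f a = Inverse.to f a ≢ a

record Perm : Set where
  constructor mkPerm
  field
    bijection     : Atom ↔ Atom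
    finiteSupport : ∃[ as ] moved bijection ⊆ (_∈ as)

open Perm

infixr 20 _⟨$⟩_
_⟨$⟩_ : Perm → Atom → Atom
π ⟨$⟩ a = Inverse.to (bijection π) a

supp : Perm → Pred Atom 0ℓ
supp π = moved (bijection π)

infixr 9 _∘ₚ_
_∘ₚ_ : Perm → Perm → Perm
π ∘ₚ ρ with finiteSupport π | finiteSupport ρ
... | as , p | bs , q = mkPerm (bijection π ↔-∘ bijection ρ) (as ++ bs , covered)
  where
  covered : moved (bijection π ↔-∘ bijection ρ) ⊆ (_∈ (as ++ bs))
  covered {a} πρa≢a with (ρ ⟨$⟩ a) ≟ a
  ... | no  ρa≢a = ∈-++⁺ʳ as (q ρa≢a)
  ... | yes ρa≡a = ∈-++⁺ˡ (p λ πa≡a → πρa≢a (trans (cong (π ⟨$⟩_) ρa≡a) πa≡a))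

infix 30 _⁻¹
_⁻¹ : Perm → Perm
π ⁻¹ with finiteSupport π
... | as , p = mkPerm (↔-sym (bijection π)) (as , λ π⁻¹a≢a → p λ πa≡a →
  π⁻¹a≢a (trans (cong (Inverse.from (bijection π)) (sym πa≡a))
                (Inverse.strictlyInverseʳ (bijection π) _)))

infixl 25 _^_
_^_ : Perm → Perm → Perm
π ^ ρ = ρ ∘ₚ π ∘ₚ ρ ⁻¹

swapAtoms : Atom → Atom → Atom → Atom
swapAtoms a b x with x ≟ a | x ≟ b
... | yes _ | _     = b
... | no  _ | yes _ = a
... | no  _ | no  _ = x

swapAtoms-involutive : ∀ a b x → swapAtoms a b (swapAtoms a b x) ≡ x
swapAtoms-involutive a b x with x ≟ a | x ≟ b
... | yes x≡a | _ with b ≟ a | b ≟ b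
...   | yes b≡a | _       = trans b≡a (sym x≡a)
...   | no  _   | yes _   = sym x≡a
...   | no  _   | no  b≢b = ⊥-elim (b≢b refl)
swapAtoms-involutive a b x | no _ | yes x≡b with a ≟ a
...   | yes _   = sym x≡b
...   | no  a≢a = ⊥-elim (a≢a refl)
swapAtoms-involutive a b x | no x≢a | no x≢b with x ≟ a | x ≟ b
...   | yes x≡a | _       = ⊥-elim (x≢a x≡a)
...   | no  _   | yes x≡b = ⊥-elim (x≢b x≡b)
...   | no  _   | no  _   = refl

swap : Atom → Atom → Perm
swap a b = mkPerm f (a ∷ b ∷ [] , covered)
  where
  f : Atom ↔ Atom
  f = mk↔ₛ′ (swapAtoms a b) (swapAtoms a b) (swapAtoms-involutive a b) (swapAtoms-involutive a b)

  covered : moved f ⊆ (_∈ (a ∷ b ∷ []))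
  covered {x} fx≢x with x ≟ a | x ≟ b
  ... | yes x≡a | _       = here x≡a
  ... | no  _   | yes x≡b = there (here x≡b)
  ... | no  _   | no  _   = ⊥-elim (fx≢x refl)

data Term (F : Set) : Set where
  atom  : Atom → Term F
  [_]_  : Atom → Term F → Term F
  tuple : List (Term F) → Term F
  app   : F → Term F → Term F
  _∙ᵛ_  : Perm → Var → Term F

module _ {F : Set} where

  infixr 20 _·_ _·*_

  mutual
    _·_ : Perm → Term F → Term F
    π · atom a    = atom (π ⟨$⟩ a)
    π · ([ a ] t) = [ π ⟨$⟩ a ] (π · t)
    π · tuple ts  = tuple (π ·* ts)
    π · app f t   = app f (π · t)
    π · (ρ ∙ᵛ X)  = (π ∘ₚ ρ) ∙ᵛ X

    _·*_ : Perm → List (Term F) → List (Term F)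
    π ·* []       = []
    π ·* (t ∷ ts) = π · t ∷ π ·* ts

  -- Purely syntactic occurrence: abstracted atoms count, and the atoms
  -- of a suspension π ∙ᵛ X are those in the support of π.
  data _occursIn_ (c : Atom) : Term F → Set where
    atom   : c occursIn atom c
    binder : ∀ {t} → c occursIn ([ c ] t)
    body   : ∀ {a t} → c occursIn t → c occursIn ([ a ] t)
    tuple  : ∀ {ts} → Any (c occursIn_) ts → c occursIn tuple ts
    app    : ∀ {f t} → c occursIn t → c occursIn app f t
    susp   : ∀ {π X} → supp π c → c occursIn (π ∙ᵛ X)

-- An element (π , X) stands for the fixed-point constraint π ⋏ X.
Context : Set
Context = List (Perm × Var)

suppPerm : Context → Var → Pred Atom 0ℓ
suppPerm Υ X a = ∃[ π ] (π , X) ∈ Υ × supp π a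

_occursInCtx_ : Atom → Context → Set
c occursInCtx Υ = ∃[ X ] suppPerm Υ X c

-- The list of new atoms is only ever consulted through membership, so
-- it is extended at the front.
infix 4 _⊢И_∙_⋏_ _⊢И_∙_≈α_

data _⊢И_∙_⋏_ {F : Set} (Υ : Context) (c̄ : List Atom) (π : Perm) : Term F → Set where

  ⋏atom : ∀ {a} →
          π ⟨$⟩ a ≡ a →
          Υ ⊢И c̄ ∙ π ⋏ atom a

  ⋏var : ∀ {π′ X} →
         supp (π ^ (π′ ⁻¹)) ∖ (_∈ c̄) ⊆ suppPerm Υ X →
         Υ ⊢И c̄ ∙ π ⋏ (π′ ∙ᵛ X)

  ⋏app : ∀ {f t} →
         Υ ⊢И c̄ ∙ π ⋏ t →
         Υ ⊢И c̄ ∙ π ⋏ app f t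

  ⋏tuple : ∀ {ts} →
           All (λ t → Υ ⊢И c̄ ∙ π ⋏ t) ts →
           Υ ⊢И c̄ ∙ π ⋏ tuple ts

  ⋏abs : ∀ {a t} (c₁ : Atom) →
         ¬ c₁ occursInCtx Υ → c₁ ∉ c̄ → ¬ supp π c₁ → ¬ c₁ occursIn ([ a ] t) →
         Υ ⊢И c₁ ∷ c̄ ∙ π ⋏ (swap a c₁ · t) →
         Υ ⊢И c̄ ∙ π ⋏ ([ a ] t)

data _⊢И_∙_≈α_ {F : Set} (Υ : Context) (c̄ : List Atom) : Term F → Term F → Set where

  ≈atom : ∀ {a} →
          Υ ⊢И c̄ ∙ atom a ≈α atom a

  ≈var : ∀ {π π′ X} →
         supp (π′ ⁻¹ ∘ₚ π) ∖ (_∈ c̄) ⊆ suppPerm Υ X →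
         Υ ⊢И c̄ ∙ (π ∙ᵛ X) ≈α (π′ ∙ᵛ X)

  ≈app : ∀ {f t t′} →
         Υ ⊢И c̄ ∙ t ≈α t′ →
         Υ ⊢И c̄ ∙ app f t ≈α app f t′

  ≈tuple : ∀ {ts ts′} →
           Pointwise (λ t t′ → Υ ⊢И c̄ ∙ t ≈α t′) ts ts′ →
           Υ ⊢И c̄ ∙ tuple ts ≈α tuple ts′

  ≈abs : ∀ {a t t′} →
         Υ ⊢И c̄ ∙ t ≈α t′ →
         Υ ⊢И c̄ ∙ ([ a ] t) ≈α ([ a ] t′)

  ≈abs′ : ∀ {a b s t} (c₁ : Atom) →
          a ≢ b →
          ¬ c₁ occursInCtx Υ → c₁ ∉ c̄ → ¬ c₁ occursIn ([ a ] s) → ¬ c₁ occursIn ([ b ] t) →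
          Υ ⊢И c̄ ∙ s ≈α (swap a b · t) →
          Υ ⊢И c₁ ∷ c̄ ∙ swap a c₁ ⋏ t →
          Υ ⊢И c̄ ∙ ([ a ] s) ≈α ([ b ] t)

{-# OPTIONS --safe #-}
-- Call an atom y free in t (relative to Υ and c̄) if it labels an unbound atom leaf, or if y = ρ(x)
-- for an unbound suspension ρ·X whose x is neither in c̄ nor in supp(perm(Υ|X)).  Then π ⋏ t is
-- derivable iff π fixes every free atom of t, and σ·u ≈α τ·u is derivable iff σ and τ agree on
-- every free atom of u; the theorem is the case σ = π, τ = Id.  Both characterisations are proved
-- by induction on u for all terms that are renamings of u, since the premises of the abstraction
-- rules are about renamed bodies.
module Submission where

open import Defs
open import Data.List.Base using (List; []; _∷_; _++_)
open import Data.List.Extrema.Nat using (max; xs≤max)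
open import Data.List.Membership.Propositional using (_∈_; _∉_; find; lose)
open import Data.List.Membership.Propositional.Properties using (∈-++⁺ˡ; ∈-++⁺ʳ)
open import Data.List.Relation.Binary.Pointwise.Base using (Pointwise; []; _∷_)
open import Data.List.Relation.Unary.All as All using (All; []; _∷_)
open import Data.List.Relation.Unary.Any using (Any; here; there; any?)
open import Data.Nat.Base using (ℕ; suc)
open import Data.Nat.Properties using (_≟_; 1+n≰n)
open import Data.Product.Base using (∃-syntax; _×_; _,_)
open import Data.Sum.Base using (inj₁; inj₂; [_,_])
open import Function.Base using (id; _∘_)
open import Function.Bundles using (_↣_; _⇔_; mk⇔; Inverse; Injection)
open import Function.Definitions using (Injective)
open import Function.Properties.Inverse using (Inverse⇒Injection)
open import Level using (0ℓ)
open import Relation.Binary.PropositionalEquality using (_≡_; _≢_; refl; sym; trans; cong; subst)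
open import Relation.Nullary using (¬_; Dec; yes; no; contradiction; ¬?; _×-dec_)
open import Relation.Nullary.Decidable using (map′; decidable-stable)
open import Relation.Unary using (Pred; _⊆_; _∪_)

-- Permutations, swappings and constraint supports

⟨$⟩-injective : ∀ π → Injective _≡_ _≡_ (π ⟨$⟩_)
⟨$⟩-injective π = Injection.injective (Inverse⇒Injection (Perm.bijection π))

⁻¹-inverseˡ : ∀ π x → π ⁻¹ ⟨$⟩ (π ⟨$⟩ x) ≡ x
⁻¹-inverseˡ π = Inverse.strictlyInverseʳ (Perm.bijection π)

⁻¹-inverseʳ : ∀ π x → π ⟨$⟩ (π ⁻¹ ⟨$⟩ x) ≡ x
⁻¹-inverseʳ π = Inverse.strictlyInverseˡ (Perm.bijection π)

¬supp⇒fixed : ∀ π {x} → ¬ supp π x → π ⟨$⟩ x ≡ x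
¬supp⇒fixed π = decidable-stable (_ ≟ _)

swap-left : ∀ a b → swap a b ⟨$⟩ a ≡ b
swap-left a b with a ≟ a | a ≟ b
... | yes _   | _ = refl
... | no  a≢a | _ = contradiction refl a≢a

swap-right : ∀ a b → swap a b ⟨$⟩ b ≡ a
swap-right a b with b ≟ a | b ≟ b
... | yes b≡a | _       = b≡a
... | no  _   | yes _   = refl
... | no  _   | no  b≢b = contradiction refl b≢b

swap-other : ∀ {a b x} → x ≢ a → x ≢ b → swap a b ⟨$⟩ x ≡ x
swap-other {a} {b} {x} x≢a x≢b with x ≟ a | x ≟ b
... | yes x≡a | _       = contradiction x≡a x≢a
... | no  _   | yes x≡b = contradiction x≡b x≢b
... | no  _   | no  _   = refl

-- The side conditions on suspensions ask for membership in this support, whereas `Free` records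
-- non-membership. Deciding it lets the completeness proofs argue by contradiction.
suppPerm? : ∀ Υ X x → Dec (suppPerm Υ X x)
suppPerm? Υ X x = map′ to from (any? (λ (π , Y) → Y ≟ X ×-dec ¬? (π ⟨$⟩ x ≟ x)) Υ)
  where
  to : Any (λ (π , Y) → Y ≡ X × supp π x) Υ → suppPerm Υ X x
  to p with find p
  ... | (π , _) , π∈Υ , refl , x∈π = π , π∈Υ , x∈π

  from : suppPerm Υ X x → Any (λ (π , Y) → Y ≡ X × supp π x) Υ
  from (π , π∈Υ , x∈π) = lose π∈Υ (refl , x∈π)

-- Fresh atoms

Finite : Pred Atom 0ℓ → Set
Finite P = ∃[ as ] P ⊆ (_∈ as)

infixr 6 _∪-finite_
_∪-finite_ : ∀ {P Q} → Finite P → Finite Q → Finite (P ∪ Q)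
(as , p) ∪-finite (bs , q) = as ++ bs , [ ∈-++⁺ˡ ∘ p , ∈-++⁺ʳ as ∘ q ]

∈-finite : ∀ as → Finite (_∈ as)
∈-finite as = as , id

fresh : ∀ {P} → Finite P → ∃[ c ] ¬ P c
-- The successor of the maximum exceeds every listed atom; the default 0 only matters for the empty
-- list.
fresh (as , p) = suc (max 0 as) , λ Pc → 1+n≰n (All.lookup (xs≤max 0 as) (p Pc))

occursInCtx-finite : ∀ Υ → Finite (_occursInCtx Υ)
occursInCtx-finite []            = [] , λ { (_ , _ , () , _) }
occursInCtx-finite ((π , X) ∷ Υ) with Perm.finiteSupport π | occursInCtx-finite Υ
... | as , p | bs , q = as ++ bs , λ where
  (_ , _ , here refl , x∈π) → ∈-++⁺ˡ (p x∈π)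
  (Y , ρ , there ρ∈Υ , x∈ρ) → ∈-++⁺ʳ as (q (Y , ρ , ρ∈Υ , x∈ρ))

module _ {F : Set} where

  mutual
    occursIn-finite : (t : Term F) → Finite (_occursIn t)
    occursIn-finite (atom a) = a ∷ [] , λ { atom → here refl }
    occursIn-finite ([ a ] t) with occursIn-finite t
    ... | as , p = a ∷ as , λ { binder → here refl ; (body o) → there (p o) }
    occursIn-finite (tuple ts) with anyOccursIn-finite ts
    ... | as , p = as , λ { (tuple o) → p o }
    occursIn-finite (app f t) with occursIn-finite t
    ... | as , p = as , λ { (app o) → p o }
    occursIn-finite (π ∙ᵛ X) with Perm.finiteSupport π
    ... | as , p = as , λ { (susp o) → p o }

    anyOccursIn-finite : (ts : List (Term F)) → Finite (λ c → Any (c occursIn_) ts)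
    anyOccursIn-finite []       = [] , λ ()
    anyOccursIn-finite (t ∷ ts) with occursIn-finite t | anyOccursIn-finite ts
    ... | as , p | bs , q = as ++ bs , λ where
      (here o)  → ∈-++⁺ˡ (p o)
      (there o) → ∈-++⁺ʳ as (q o)

  -- Renamings

  -- Renames f u s says that s is f · u up to extensional equality of the suspended permutations;
  -- Id · u is in general not propositionally equal to u.
  data Renames (f : Atom → Atom) : Term F → Term F → Set where
    atom  : ∀ {a b} → b ≡ f a → Renames f (atom a) (atom b)
    abs   : ∀ {a b u s} → b ≡ f a → Renames f u s → Renames f ([ a ] u) ([ b ] s)
    tuple : ∀ {us ss} → Pointwise (Renames f) us ss → Renames f (tuple us) (tuple ss)
    app   : ∀ {g u s} → Renames f u s → Renames f (app g u) (app g s)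
    susp  : ∀ {ρ ρ′ X} → (∀ x → ρ′ ⟨$⟩ x ≡ f (ρ ⟨$⟩ x)) → Renames f (ρ ∙ᵛ X) (ρ′ ∙ᵛ X)

  mutual
    renames-id : ∀ t → Renames id t t
    renames-id (atom a)   = atom refl
    renames-id ([ a ] t)  = abs refl (renames-id t)
    renames-id (tuple ts) = tuple (renames*-id ts)
    renames-id (app f t)  = app (renames-id t)
    renames-id (ρ ∙ᵛ X)   = susp λ _ → refl

    renames*-id : ∀ ts → Pointwise (Renames id) ts ts
    renames*-id []       = []
    renames*-id (t ∷ ts) = renames-id t ∷ renames*-id ts

  mutual
    renames-· : ∀ {f u s} π → Renames f u s → Renames ((π ⟨$⟩_) ∘ f) u (π · s)
    renames-· π (atom eq)  = atom (cong (π ⟨$⟩_) eq)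
    renames-· π (abs eq r) = abs (cong (π ⟨$⟩_) eq) (renames-· π r)
    renames-· π (tuple rs) = tuple (renames*-· π rs)
    renames-· π (app r)    = app (renames-· π r)
    renames-· π (susp eq)  = susp λ x → cong (π ⟨$⟩_) (eq x)

    renames*-· : ∀ {f us ss} π → Pointwise (Renames f) us ss →
                 Pointwise (Renames ((π ⟨$⟩_) ∘ f)) us (π ·* ss)
    renames*-· π []       = []
    renames*-· π (r ∷ rs) = renames-· π r ∷ renames*-· π rs

  renames-perm : ∀ π t → Renames (π ⟨$⟩_) t (π · t)
  renames-perm π t = renames-· π (renames-id t)

  module _ (Υ : Context) where

    -- Free atoms

    -- In `susp`, both `c̄` and the context are consulted at the preimage `x`, before `ρ` acts. A
    -- renaming changes `ρ` only, so the same `x` still serves as witness afterwards.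
    data Free (c̄ : List Atom) (y : Atom) : Term F → Set where
      atom  : Free c̄ y (atom y)
      abs   : ∀ {a t} → y ≢ a → Free c̄ y t → Free c̄ y ([ a ] t)
      tuple : ∀ {ts} → Any (Free c̄ y) ts → Free c̄ y (tuple ts)
      app   : ∀ {f t} → Free c̄ y t → Free c̄ y (app f t)
      susp  : ∀ {ρ X} x → ρ ⟨$⟩ x ≡ y → x ∉ c̄ → ¬ suppPerm Υ X x → Free c̄ y (ρ ∙ᵛ X)

    module _ {c : Atom} {c̄ : List Atom} {y : Atom} where

      mutual
        -- The list is consulted only through `x ∉ c̄`, so shortening it cannot destroy freeness.
        free-unextend : ∀ {t} → Free (c ∷ c̄) y t → Free c̄ y t
        free-unextend atom               = atom
        free-unextend (abs y≢a p)        = abs y≢a (free-unextend p)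
        free-unextend (tuple ps)         = tuple (anyFree-unextend ps)
        free-unextend (app p)            = app (free-unextend p)
        free-unextend (susp x eq x∉ x∉Υ) = susp x eq (x∉ ∘ there) x∉Υ

        anyFree-unextend : ∀ {ts} → Any (Free (c ∷ c̄) y) ts → Any (Free c̄ y) ts
        anyFree-unextend (here p)   = here (free-unextend p)
        anyFree-unextend (there ps) = there (anyFree-unextend ps)

      mutual
        -- Only a suspension with `x` equal to `c` could lose its free atom. Since `c` is outside
        -- the support of `ρ`, that atom would be `c` itself, which `y ≢ c` excludes.
        free-extend : ∀ {t} → y ≢ c → ¬ c occursIn t → Free c̄ y t → Free (c ∷ c̄) y t
        free-extend y≢c c∉t atom        = atom
        free-extend y≢c c∉t (abs y≢a p) = abs y≢a (free-extend y≢c (c∉t ∘ body) p)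
        free-extend y≢c c∉t (tuple ps)  = tuple (anyFree-extend y≢c (c∉t ∘ tuple) ps)
        free-extend y≢c c∉t (app p)     = app (free-extend y≢c (c∉t ∘ app) p)
        free-extend y≢c c∉t (susp {ρ} x eq x∉ x∉Υ) = susp x eq x∉′ x∉Υ
          where
          x∉′ : x ∉ c ∷ c̄
          x∉′ (here refl) = y≢c (trans (sym eq) (¬supp⇒fixed ρ (c∉t ∘ susp)))
          x∉′ (there x∈)  = x∉ x∈

        anyFree-extend : ∀ {ts} → y ≢ c → ¬ Any (c occursIn_) ts →
                         Any (Free c̄ y) ts → Any (Free (c ∷ c̄) y) ts
        anyFree-extend y≢c c∉ts (here p)   = here (free-extend y≢c (c∉ts ∘ here) p)
        anyFree-extend y≢c c∉ts (there ps) = there (anyFree-extend y≢c (c∉ts ∘ there) ps)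

    mutual
      -- A free leaf label occurs in the term. In a suspension `ρ` fixes `c`, so the preimage of `c`
      -- is `c`, which the extended list rules out.
      new-not-free : ∀ {c c̄ t} → ¬ c occursIn t → ¬ Free (c ∷ c̄) c t
      new-not-free c∉t atom       = c∉t atom
      new-not-free c∉t (abs _ p)  = new-not-free (c∉t ∘ body) p
      new-not-free c∉t (tuple ps) = new-not-anyFree (c∉t ∘ tuple) ps
      new-not-free c∉t (app p)    = new-not-free (c∉t ∘ app) p
      new-not-free c∉t (susp {ρ} x eq x∉ _) =
        x∉ (here (⟨$⟩-injective ρ (trans eq (sym (¬supp⇒fixed ρ (c∉t ∘ susp))))))

      new-not-anyFree : ∀ {c c̄ ts} → ¬ Any (c occursIn_) ts → ¬ Any (Free (c ∷ c̄) c) ts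
      new-not-anyFree c∉ts (here p)   = new-not-free (c∉ts ∘ here) p
      new-not-anyFree c∉ts (there ps) = new-not-anyFree (c∉ts ∘ there) ps

    module _ {f : Atom → Atom} {c̄ : List Atom} where

      module _ (f-inj : Injective _≡_ _≡_ f) {y : Atom} where
        mutual
          -- Injectivity prevents capture: an atom different from the binder keeps an image
          -- different from the renamed binder.
          free-rename : ∀ {u s} → Renames f u s → Free c̄ y u → Free c̄ (f y) s
          free-rename (atom refl)  atom        = atom
          free-rename (abs refl r) (abs y≢a p) = abs (y≢a ∘ f-inj) (free-rename r p)
          free-rename (tuple rs)   (tuple ps)  = tuple (anyFree-rename rs ps)
          free-rename (app r)      (app p)     = app (free-rename r p)
          free-rename (susp ρ′≗fρ) (susp x eq x∉ x∉Υ) =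
            susp x (trans (ρ′≗fρ x) (cong f eq)) x∉ x∉Υ

          anyFree-rename : ∀ {us ss} → Pointwise (Renames f) us ss →
                           Any (Free c̄ y) us → Any (Free c̄ (f y)) ss
          anyFree-rename (r ∷ _)  (here p)   = here (free-rename r p)
          anyFree-rename (_ ∷ rs) (there ps) = there (anyFree-rename rs ps)

      mutual
        free-unrename : ∀ {u s z} → Renames f u s → Free c̄ z s → ∃[ y ] z ≡ f y × Free c̄ y u
        free-unrename (atom eq)    atom        = _ , eq , atom
        free-unrename (abs refl r) (abs z≢b p) with free-unrename r p
        ... | y , refl , q = y , refl , abs (z≢b ∘ cong f) q
        free-unrename (tuple rs)   (tuple ps)  with anyFree-unrename rs ps
        ... | y , eq , qs = y , eq , tuple qs
        free-unrename (app r)      (app p)     with free-unrename r p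
        ... | y , eq , q = y , eq , app q
        free-unrename (susp ρ′≗fρ) (susp x eq x∉ x∉Υ) =
          _ , trans (sym eq) (ρ′≗fρ x) , susp x refl x∉ x∉Υ

        anyFree-unrename : ∀ {us ss z} → Pointwise (Renames f) us ss →
                           Any (Free c̄ z) ss → ∃[ y ] z ≡ f y × Any (Free c̄ y) us
        anyFree-unrename (r ∷ _)  (here p)   with free-unrename r p
        ... | y , eq , q = y , eq , here q
        anyFree-unrename (_ ∷ rs) (there ps) with anyFree-unrename rs ps
        ... | y , eq , qs = y , eq , there qs

    -- Fixed-point judgements

    mutual
      ⋏⇒fixes-free : ∀ {c̄ π t} → Υ ⊢И c̄ ∙ π ⋏ t → ∀ {y} → Free c̄ y t → π ⟨$⟩ y ≡ y
      ⋏⇒fixes-free (⋏atom πa≡a) atom       = πa≡a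
      ⋏⇒fixes-free (⋏app d)     (app p)    = ⋏⇒fixes-free d p
      ⋏⇒fixes-free (⋏tuple ds)  (tuple ps) = ⋏*⇒fixes-free ds ps
      ⋏⇒fixes-free {π = π} (⋏var {π′} S) (susp x refl x∉ x∉Υ) =
        -- If the conjugate fixed `x`, applying `π′` to both sides would show that `π` fixes
        -- `π′ ⟨$⟩ x`.
        ¬supp⇒fixed π λ moved → x∉Υ (S
          ((λ eq → moved (trans (sym (⁻¹-inverseʳ π′ _)) (cong (π′ ⟨$⟩_) eq))) , x∉))
      ⋏⇒fixes-free {π = π} (⋏abs {a} {t} c₁ _ _ c₁∉π c₁∉t d) {y} (abs y≢a p) with y ≟ c₁
      -- The new atom can be free without occurring, through a suspension that fixes it; then its
      -- being outside the support of `π` settles the case. Any other `y` is untouched by the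
      -- swapping and stays free in the premise.
      ... | yes refl = ¬supp⇒fixed π c₁∉π
      ... | no  y≢c₁ = subst (λ z → π ⟨$⟩ z ≡ z) (swap-other y≢a y≢c₁) (⋏⇒fixes-free d
                         (free-rename (⟨$⟩-injective (swap a c₁)) (renames-perm (swap a c₁) t)
                           (free-extend y≢c₁ (c₁∉t ∘ body) p)))

      ⋏*⇒fixes-free : ∀ {c̄ π ts} → All (λ t → Υ ⊢И c̄ ∙ π ⋏ t) ts →
                      ∀ {y} → Any (Free c̄ y) ts → π ⟨$⟩ y ≡ y
      ⋏*⇒fixes-free (d ∷ _)  (here p)   = ⋏⇒fixes-free d p
      ⋏*⇒fixes-free (_ ∷ ds) (there ps) = ⋏*⇒fixes-free ds ps

    mutual
      -- The recursion descends on `u`: each abstraction composes one more swapping into `f`, while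
      -- the hypothesis speaks of the actual term `s`.
      fixes-free⇒⋏′ : ∀ {f u s c̄} π → Renames f u s → (∀ {y} → Free c̄ y s → π ⟨$⟩ y ≡ y) →
                      Υ ⊢И c̄ ∙ π ⋏ s
      fixes-free⇒⋏′ π (atom _)   fix = ⋏atom (fix atom)
      fixes-free⇒⋏′ π (tuple rs) fix = ⋏tuple (fixes-free⇒⋏*′ π rs (fix ∘ tuple))
      fixes-free⇒⋏′ π (app r)    fix = ⋏app (fixes-free⇒⋏′ π r (fix ∘ app))
      -- Were `x` outside the support of the constraints, `ρ ⟨$⟩ x` would be free and hence fixed by
      -- `π`, so the conjugate would not move `x`.
      fixes-free⇒⋏′ π (susp {ρ′ = ρ} {X} _) fix = ⋏var λ {x} (moved , x∉) →
        decidable-stable (suppPerm? Υ X x) λ x∉Υ →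
          moved (trans (cong (ρ ⁻¹ ⟨$⟩_) (fix (susp x refl x∉ x∉Υ))) (⁻¹-inverseˡ ρ x))
      fixes-free⇒⋏′ {c̄ = c̄} π (abs {b = b} {s = s} _ r) fix
        with fresh (occursInCtx-finite Υ ∪-finite ∈-finite c̄ ∪-finite
                    Perm.finiteSupport π ∪-finite occursIn-finite ([ b ] s))
      ... | c , c-new = ⋏abs c (c-new ∘ inj₁) (c-new ∘ inj₂ ∘ inj₁) c∉π c∉s
                          (fixes-free⇒⋏′ π (renames-· (swap b c) r) fix′)
        where
        c∉π : ¬ supp π c
        c∉π = c-new ∘ inj₂ ∘ inj₂ ∘ inj₁

        c∉s : ¬ c occursIn ([ b ] s)
        c∉s = c-new ∘ inj₂ ∘ inj₂ ∘ inj₂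

        -- The binder `b` is sent to `c`, which `π` fixes by freshness. Any other `z` also differs
        -- from `c`, so the swapping leaves it alone and it is free in the whole abstraction.
        fix-swapped : ∀ {z} → Free (c ∷ c̄) z s → Dec (z ≡ b) →
                      π ⟨$⟩ (swap b c ⟨$⟩ z) ≡ swap b c ⟨$⟩ z
        fix-swapped q (yes refl) =
          subst (λ v → π ⟨$⟩ v ≡ v) (sym (swap-left b c)) (¬supp⇒fixed π c∉π)
        fix-swapped q (no z≢b) =
          subst (λ v → π ⟨$⟩ v ≡ v)
            (sym (swap-other z≢b λ { refl → new-not-free (c∉s ∘ body) q }))
            (fix (abs z≢b (free-unextend q)))

        fix′ : ∀ {y} → Free (c ∷ c̄) y (swap b c · s) → π ⟨$⟩ y ≡ y
        fix′ p with free-unrename (renames-perm (swap b c) s) p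
        ... | z , refl , q = fix-swapped q (z ≟ b)

      fixes-free⇒⋏*′ : ∀ {f us ss c̄} π → Pointwise (Renames f) us ss →
                       (∀ {y} → Any (Free c̄ y) ss → π ⟨$⟩ y ≡ y) →
                       All (λ s → Υ ⊢И c̄ ∙ π ⋏ s) ss
      fixes-free⇒⋏*′ π []       fix = []
      fixes-free⇒⋏*′ π (r ∷ rs) fix =
        fixes-free⇒⋏′ π r (fix ∘ here) ∷ fixes-free⇒⋏*′ π rs (fix ∘ there)

    fixes-free⇒⋏ : ∀ {c̄} π t → (∀ {y} → Free c̄ y t → π ⟨$⟩ y ≡ y) → Υ ⊢И c̄ ∙ π ⋏ t
    fixes-free⇒⋏ π t = fixes-free⇒⋏′ π (renames-id t)

    -- α-equivalence judgements

    mutual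
      -- Both sides are compared through their common source `u`. The rule `≈abs′` swaps only on the
      -- right, so `g` absorbs the swapping, stays injective, and `f` is unchanged.
      ≈α⇒agree-on-free : ∀ {f g u s t c̄} → Injective _≡_ _≡_ g → Renames f u s → Renames g u t →
                         Υ ⊢И c̄ ∙ s ≈α t → ∀ {y} → Free c̄ y u → f y ≡ g y
      ≈α⇒agree-on-free g-inj (atom eq)  (atom eq′)  ≈atom       atom       = trans (sym eq) eq′
      ≈α⇒agree-on-free g-inj (tuple rs) (tuple rs′) (≈tuple ds) (tuple ps) =
        ≈α*⇒agree-on-free g-inj rs rs′ ds ps
      ≈α⇒agree-on-free g-inj (app r)    (app r′)    (≈app d)    (app p)    =
        ≈α⇒agree-on-free g-inj r r′ d p
      ≈α⇒agree-on-free {f} {g} g-inj (susp {ρ} {σ} σ≗fρ) (susp {ρ′ = τ} τ≗gρ) (≈var S)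
                       (susp x refl x∉ x∉Υ) = trans (sym (σ≗fρ x)) (trans σx≡τx (τ≗gρ x))
        where
        σx≡τx : σ ⟨$⟩ x ≡ τ ⟨$⟩ x
        σx≡τx = decidable-stable (_ ≟ _) λ σx≢τx → x∉Υ (S
          ((λ eq → σx≢τx (trans (sym (⁻¹-inverseʳ τ _)) (cong (τ ⟨$⟩_) eq))) , x∉))
      ≈α⇒agree-on-free g-inj (abs _ r)  (abs _ r′)  (≈abs d)    (abs _ p)  =
        ≈α⇒agree-on-free g-inj r r′ d p
      ≈α⇒agree-on-free {f} {g} g-inj (abs {a} refl r) (abs refl r′)
                       (≈abs′ c₁ _ _ _ c₁∉s c₁∉t d e) {y} (abs y≢a p) =
        trans (≈α⇒agree-on-free (g-inj ∘ ⟨$⟩-injective (swap (f a) (g a))) r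
                 (renames-· (swap (f a) (g a)) r′) d p)
              (swap-other gy≢fa (y≢a ∘ g-inj))
        where
        fa≢c₁ : f a ≢ c₁
        fa≢c₁ refl = c₁∉s binder

        -- This is the content of the fixed-point premise `e`: if `g y` were `f a`, then `f a` would
        -- be free in the body on the right, yet the swapping sends it to `c₁`.
        gy≢fa : g y ≢ f a
        gy≢fa gy≡fa = fa≢c₁ (trans
          (sym (⋏⇒fixes-free e (free-extend fa≢c₁ (c₁∉t ∘ body)
            (subst (λ z → Free _ z _) gy≡fa (free-rename g-inj r′ p)))))
          (swap-left (f a) c₁))

      ≈α*⇒agree-on-free : ∀ {f g us ss ts c̄} → Injective _≡_ _≡_ g →
                          Pointwise (Renames f) us ss → Pointwise (Renames g) us ts →
                          Pointwise (λ s t → Υ ⊢И c̄ ∙ s ≈α t) ss ts →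
                          ∀ {y} → Any (Free c̄ y) us → f y ≡ g y
      ≈α*⇒agree-on-free g-inj (r ∷ _)  (r′ ∷ _)   (d ∷ _)  (here p)   =
        ≈α⇒agree-on-free g-inj r r′ d p
      ≈α*⇒agree-on-free g-inj (_ ∷ rs) (_ ∷ rs′) (_ ∷ ds) (there ps) =
        ≈α*⇒agree-on-free g-inj rs rs′ ds ps

    mutual
      agree-on-free⇒≈α : ∀ {f g u s t c̄} → Injective _≡_ _≡_ f → Injective _≡_ _≡_ g →
                         Renames f u s → Renames g u t →
                         (∀ {y} → Free c̄ y u → f y ≡ g y) → Υ ⊢И c̄ ∙ s ≈α t
      agree-on-free⇒≈α f-inj g-inj (atom refl) (atom refl) agree rewrite agree atom = ≈atom
      agree-on-free⇒≈α f-inj g-inj (tuple rs) (tuple rs′) agree =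
        ≈tuple (agree-on-free⇒≈α* f-inj g-inj rs rs′ (agree ∘ tuple))
      agree-on-free⇒≈α f-inj g-inj (app r) (app r′) agree =
        ≈app (agree-on-free⇒≈α f-inj g-inj r r′ (agree ∘ app))
      agree-on-free⇒≈α f-inj g-inj (susp {ρ′ = σ} {X} σ≗fρ) (susp {ρ′ = τ} τ≗gρ) agree =
        ≈var λ {x} (moved , x∉) → decidable-stable (suppPerm? Υ X x) λ x∉Υ →
          moved (trans (cong (τ ⁻¹ ⟨$⟩_)
                         (trans (σ≗fρ x) (trans (agree (susp x refl x∉ x∉Υ)) (sym (τ≗gρ x)))))
                       (⁻¹-inverseˡ τ x))
      agree-on-free⇒≈α {f} {g} {c̄ = c̄} f-inj g-inj (abs {a} {u = u} {s} refl r)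
                       (abs {s = t} refl r′) agree
        -- Whether the renamed binders coincide decides between `≈abs` and `≈abs′`.
        with f a ≟ g a
      ... | yes fa≡ga = subst (λ b → Υ ⊢И c̄ ∙ ([ f a ] s) ≈α ([ b ] t)) fa≡ga
                          (≈abs (agree-on-free⇒≈α f-inj g-inj r r′ agree′))
        where
        agree′ : ∀ {y} → Free c̄ y u → f y ≡ g y
        agree′ {y} p with y ≟ a
        ... | yes refl = fa≡ga
        ... | no  y≢a  = agree (abs y≢a p)
      ... | no  fa≢ga
        with fresh (occursInCtx-finite Υ ∪-finite ∈-finite c̄ ∪-finite
                    occursIn-finite ([ f a ] s) ∪-finite occursIn-finite ([ g a ] t))
      ... | c , c-new =
        ≈abs′ c fa≢ga (c-new ∘ inj₁) (c-new ∘ inj₂ ∘ inj₁) (c-new ∘ inj₂ ∘ inj₂ ∘ inj₁) c∉t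
          (agree-on-free⇒≈α f-inj (g-inj ∘ ⟨$⟩-injective (swap (f a) (g a))) r
            (renames-· (swap (f a) (g a)) r′) agree′)
          (fixes-free⇒⋏ (swap (f a) c) t fix)
        where
        c∉t : ¬ c occursIn ([ g a ] t)
        c∉t = c-new ∘ inj₂ ∘ inj₂ ∘ inj₂

        -- For the bound atom this is `fa≢ga`. For any other `y`, agreement would give equal
        -- `f`-images of `y` and `a`, against injectivity of `f`.
        gy≢fa : ∀ {y} → Free c̄ y u → g y ≢ f a
        gy≢fa {y} p gy≡fa with y ≟ a
        ... | yes refl = fa≢ga (sym gy≡fa)
        ... | no  y≢a  = y≢a (f-inj (trans (agree (abs y≢a p)) gy≡fa))

        -- The swapping repairs the disagreement at the binder, taking `g a` to `f a`, and moves no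
        -- other `g y`.
        agree′ : ∀ {y} → Free c̄ y u → f y ≡ swap (f a) (g a) ⟨$⟩ g y
        agree′ {y} p with y ≟ a
        ... | yes refl = sym (swap-right (f a) (g a))
        ... | no  y≢a  = trans (agree (abs y≢a p)) (sym (swap-other (gy≢fa p) (y≢a ∘ g-inj)))

        -- Free atoms of `t` are images `g y`; these avoid `f a` by `gy≢fa` and avoid `c` because
        -- `c` is new.
        fix : ∀ {z} → Free (c ∷ c̄) z t → swap (f a) c ⟨$⟩ z ≡ z
        fix q with free-unrename r′ (free-unextend q)
        ... | _ , refl , p =
          swap-other (gy≢fa p)
            λ gy≡c → new-not-free (c∉t ∘ body) (subst (λ z → Free (c ∷ c̄) z t) gy≡c q)

      agree-on-free⇒≈α* : ∀ {f g us ss ts c̄} → Injective _≡_ _≡_ f → Injective _≡_ _≡_ g →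
                          Pointwise (Renames f) us ss → Pointwise (Renames g) us ts →
                          (∀ {y} → Any (Free c̄ y) us → f y ≡ g y) →
                          Pointwise (λ s t → Υ ⊢И c̄ ∙ s ≈α t) ss ts
      agree-on-free⇒≈α* f-inj g-inj []       []         agree = []
      agree-on-free⇒≈α* f-inj g-inj (r ∷ rs) (r′ ∷ rs′) agree =
        agree-on-free⇒≈α f-inj g-inj r r′ (agree ∘ here) ∷
        agree-on-free⇒≈α* f-inj g-inj rs rs′ (agree ∘ there)

theorem3p12 : {F : Set} → F ↣ ℕ → (Υ : Context) (c̄ : List Atom) (π : Perm) (t : Term F) → (Υ ⊢И c̄ ∙ π ⋏ t) ⇔ (Υ ⊢И c̄ ∙ (π · t) ≈α t)
theorem3p12 _ Υ c̄ π t = mk⇔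
  -- With `id` as the second renaming, agreement at `y` reads `π ⟨$⟩ y ≡ y` definitionally, so the
  -- two characterisations compose directly.
  (λ d → agree-on-free⇒≈α Υ (⟨$⟩-injective π) id (renames-perm π t) (renames-id t)
           (⋏⇒fixes-free Υ d))
  (λ d → fixes-free⇒⋏ Υ π t (≈α⇒agree-on-free Υ id (renames-perm π t) (renames-id t) d))
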